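{- Let $(Q,\leq)$ be a well-quasi-order and let $N$ be a fixed positive integer. If $D_1, D_2, \ldots$ is an infinite sequence of $Q$-labelled graphic sequences such that, for every $i$, at most $N$ of the degree entries of $D_i$ exceed $N$, then there exist indices $i < j$ such that $D_i \leq D_j$.
   Context: All graphs are finite and simple (no loops, no multiple edges). An integer sequence $(d_1,\ldots,d_n)$ with $d_1 \geq \cdots \geq d_n \geq 1$ is graphic if there exists a graph whose vertex degrees are $d_1,\ldots,d_n$. A quasi-order is a pair $(Q,\leq)$ where $\leq$ is a reflexive and transitive relation on the set $Q$. It is a well-quasi-order (WQO) if for every infinite sequence $q_1,q_2,\ldots$ in $Q$ there exist $i<j$ with $q_i \leq q_j$. Let $(Q,\leq)$ be a WQO. A $Q$-labelled graphic sequence is a sequence $((d_1,q_1),\ldots,(d_n,q_n))$ where $(d_1,\ldots,d_n)$ is a graphic sequence and $q_i \in Q$ for $1 \leq i \leq n$; its degree entries are $d_1,\ldots,d_n$. A $Q$-labelled graph is a pair $(G,f_G)$ where $G$ is a graph and $f_G : V(G) \to Q$ is a function. A $Q$-labelled graph $G$ is an induced subgraph of a $Q$-labelled graph $H$ if there exists an injection $\phi : V(G) \to V(H)$ such that (i) for all $x,y \in V(G)$, $xy \in E(G)$ if and only if $\phi(x)\phi(y) \in E(H)$, and (ii) $f_G(x) \leq f_H(\phi(x))$ for all $x \in V(G)$. A $Q$-labelled graph $(G,f)$ realizes $((d_1,q_1),\ldots,(d_n,q_n))$ if $V(G) = \{x_1,\ldots,x_n\}$ (with the $x_i$ distinct),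 where $x_i$ has degree $d_i$ and $f(x_i) = q_i$ for $1 \leq i \leq n$. For $Q$-labelled graphic sequences $D_1, D_2$, write $D_1 \leq D_2$ if there exist $Q$-labelled graphs $G_1$ and $G_2$ such that $G_1$ realizes $D_1$, $G_2$ realizes $D_2$, and $G_1$ is an induced subgraph of $G_2$ (as $Q$-labelled graphs). -}

module Defs where

open import Data.Fin.Base as Fin using (Fin)
open import Data.Nat.Base as ℕ using (ℕ)
open import Data.Nat.Properties using (_<?_)
open import Data.Product.Base using (Σ-syntax; ∃₂; ∃-syntax; _×_)
open import Data.Vec.Base using (allFin; count)
open import Data.Vec.Functional using (Vector)
open import Function.Bundles using (_⇔_)
open import Function.Definitions using (Bijective; Injective)
open import Level using (Level; 0ℓ; suc; _⊔_)
open import Relation.Binary.Core using (Rel)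
open import Relation.Binary.Definitions using (Decidable; Irreflexive; Symmetric)
open import Relation.Binary.PropositionalEquality.Core using (_≡_)
open import Relation.Binary.Structures using (IsPreorder)

record IsWellQuasiOrder {a ℓ : Level} {Q : Set a} (_≤_ : Rel Q ℓ) : Set (a ⊔ ℓ) where
  field
    isPreorder : IsPreorder _≡_ _≤_
    good       : (q : ℕ → Q) → ∃₂ λ i j → (i ℕ.< j) × (q i ≤ q j)

-- Adjacency is decidable so that degrees are natural numbers.
record Graph : Set₁ where
  infix 4 _~_ _~?_
  field
    order       : ℕ

  Vertex : Set
  Vertex = Fin order

  field
    _~_         : Rel Vertex 0ℓ
    _~?_        : Decidable _~_
    irreflexive : Irreflexive _≡_ _~_
    symmetric   : Symmetric _~_

  degree : Vertex → ℕ
  degree x = count (x ~?_) (allFin order)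

open Graph using (Vertex; degree)

record IsGraphic {n : ℕ} (d : Vector ℕ n) : Set₁ where
  field
    nonincreasing : ∀ i j → i Fin.≤ j → d j ℕ.≤ d i
    positive      : ∀ i → 1 ℕ.≤ d i
    realizable    : Σ[ G ∈ Graph ] Σ[ x ∈ (Fin n → Vertex G) ]
                    Bijective _≡_ _≡_ x × (∀ i → degree G (x i) ≡ d i)

record LabelledGraphicSequence {a : Level} (Q : Set a) : Set (suc 0ℓ ⊔ a) where
  field
    length    : ℕ
    degrees   : Vector ℕ length
    labels    : Vector Q length
    isGraphic : IsGraphic degrees

  #entries> : ℕ → ℕ
  #entries> N = count (λ i → N <? degrees i) (allFin length)

record LabelledGraph {a : Level} (Q : Set a) : Set (suc 0ℓ ⊔ a) where
  field
    graph : Graph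
    label : Vertex graph → Q

  open Graph graph public

Realizes : {a : Level} {Q : Set a} → LabelledGraph Q → LabelledGraphicSequence Q → Set a
Realizes G D =
  ∃[ x ] Bijective _≡_ _≡_ x
       × (∀ (i : Fin D.length) → G.degree (x i) ≡ D.degrees i × G.label (x i) ≡ D.labels i)
  where
  module G = LabelledGraph G
  module D = LabelledGraphicSequence D

module _ {a ℓ : Level} {Q : Set a} (_≤_ : Rel Q ℓ) where

  InducedSubgraph : Rel (LabelledGraph Q) ℓ
  InducedSubgraph G H =
    Σ[ φ ∈ (G.Vertex → H.Vertex) ] Injective _≡_ _≡_ φ
      × (∀ x y → (x G.~ y) ⇔ (φ x H.~ φ y))
      × (∀ x → G.label x ≤ H.label (φ x))
    where
    module G = LabelledGraph G
    module H = LabelledGraph H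

  SequenceOrder : Rel (LabelledGraphicSequence Q) (suc 0ℓ ⊔ a ⊔ ℓ)
  SequenceOrder D₁ D₂ =
    ∃₂ λ G₁ G₂ → Realizes G₁ D₁ × Realizes G₂ D₂ × InducedSubgraph G₁ G₂

{-# OPTIONS --safe #-}

-- Realize every D by a graph and call its first N vertices the core; all other
-- vertices have degree at most N.  Record, for each vertex v, which core vertex
-- it is (if any), its core neighbours, the number of its neighbours outside the
-- core, and its label.  By Higman's lemma some graph G earlier in the sequence
-- maps into a later graph H by an injection φ compatible with this data.  In H
-- we keep the edges meeting the core, and replace the others: on the image of φ
-- by those of G, and elsewhere by a disjoint union of cliques K_{s+1} on the
-- vertices with s neighbours outside the core.  The latter is possible if the
-- number of these vertices is divisible by s + 1, which is ensured by also
-- recording, for each s ≤ N, the residue mod s + 1 of their number in each graph.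

module Submission where

open import Defs
open import Axiom.ExcludedMiddle using (ExcludedMiddle)
open import Data.Bool.Base using (if_then_else_)
open import Data.Empty using (⊥)
open import Data.Fin.Base as Fin
  using (Fin; zero; suc; toℕ; fromℕ<; inject≤; combine; punchIn; punchOut)
import Data.Fin.Properties as Fin
open import Data.Nat.Base as ℕ using (ℕ; zero; suc; _+_; _*_; _∸_; _≤′_; ≤′-refl; ≤′-step)
open import Data.Nat.Divisibility using (_∣_; divides; ∣m+n∣m⇒∣n)
open import Data.Nat.DivMod using (_%_; _/_; _mod_; m≡m%n+[m/n]*n; m%n<n; m≤n⇒m%n≡m)
open import Data.Nat.Induction using (<-wellFounded)
import Data.Nat.Properties as ℕ
open import Data.Product.Base
  using (Σ-syntax; ∃; ∃₂; ∃-syntax; _×_; _,_; proj₁; proj₂; uncurry)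
open import Data.Sum.Base using (_⊎_; inj₁; inj₂)
open import Data.Unit.Base using (tt)
open import Data.Vec.Base using (Vec; []; _∷_; lookup; allFin; count)
open import Data.Vec.Functional using (Vector; head; tail)
open import Data.Vec.Properties using (count≤n; lookup-allFin)
open import Function.Base using (_∘_; id; _on_)
open import Function.Bundles using (_⇔_; mk⇔)
open import Function.Definitions using (Bijective; Injective)
open import Induction.WellFounded using (Acc; acc)
open import Level using (Level; 0ℓ; _⊔_)
open import Relation.Binary.Construct.Intersection using () renaming (_∩_ to _∩ʳ_)
open import Relation.Binary.Core using (Rel)
open import Relation.Binary.Definitions using (Irreflexive; Reflexive; Symmetric; Transitive)
open import Relation.Binary.PropositionalEquality
  using (_≡_; _≢_; refl; sym; trans; cong; cong₂; subst; subst₂; isEquivalence; module ≡-Reasoning)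
open import Relation.Binary.Structures using (IsPreorder)
open import Relation.Nullary using (¬_; Dec; yes; no; does; contradiction)
open import Relation.Nullary.Decidable using (decidable-stable)
open import Relation.Unary using (Pred; Decidable; _∩_; ∁; U)

private
  variable
    a b p q ℓ ℓ′ : Level
    A B : Set a
    k m n : ℕ

-- Well-quasi-orders

record Word (A : Set a) : Set a where
  constructor word
  field
    {length} : ℕ
    letters  : Vector A length

-- The map need not be increasing, unlike in the usual subword order: vertices of a graph carry no
-- order that has to be kept.
record Embeds {A : Set a} (_≤_ : Rel A ℓ) (v w : Word A) : Set ℓ where
  constructor embedding
  field
    map       : Fin (Word.length v) → Fin (Word.length w)
    injective : Injective _≡_ _≡_ map
    letter-≤  : ∀ i → Word.letters v i ≤ Word.letters w (map i)

module _ {_≤_ : Rel A ℓ} where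

  embeds-refl : (∀ {x} → x ≤ x) → Reflexive (Embeds _≤_)
  embeds-refl ≤-refl = embedding id id (λ _ → ≤-refl)

  embeds-trans : Transitive _≤_ → Transitive (Embeds _≤_)
  embeds-trans ≤-trans (embedding φ φ-inj φ-≤) (embedding ψ ψ-inj ψ-≤) =
    embedding (ψ ∘ φ) (φ-inj ∘ ψ-inj) (λ i → ≤-trans (φ-≤ i) (ψ-≤ (φ i)))

  embeds-isPreorder : IsPreorder _≡_ _≤_ → IsPreorder _≡_ (Embeds _≤_)
  embeds-isPreorder ≤-pre = record
    { isEquivalence = isEquivalence
    ; reflexive     = λ { refl → embeds-refl (IsPreorder.refl ≤-pre) }
    ; trans         = embeds-trans (IsPreorder.trans ≤-pre)
    }

  embeds-empty : (v : Vector A 0) (w : Word A) → Embeds _≤_ (word v) w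
  embeds-empty v w = embedding (λ ()) (λ { {()} }) (λ ())

  embeds-tail : (∀ {x} → x ≤ x) → (v : Vector A (suc n)) → Embeds _≤_ (word (tail v)) (word v)
  embeds-tail ≤-refl v = embedding suc Fin.suc-injective (λ _ → ≤-refl)

  embeds-cons : (v : Vector A (suc m)) (w : Vector A (suc n)) → head v ≤ head w →
                Embeds _≤_ (word (tail v)) (word (tail w)) → Embeds _≤_ (word v) (word w)
  embeds-cons v w v₀≤w₀ (embedding φ φ-inj φ-≤) = embedding ψ ψ-inj ψ-≤
    where
    ψ : Fin (suc _) → Fin (suc _)
    ψ zero    = zero
    ψ (suc i) = suc (φ i)

    ψ-inj : Injective _≡_ _≡_ ψ
    ψ-inj {zero}  {zero}  _  = refl
    ψ-inj {suc i} {suc j} eq = cong suc (φ-inj (Fin.suc-injective eq))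
    ψ-inj {zero}  {suc _} ()
    ψ-inj {suc _} {zero}  ()

    ψ-≤ : ∀ i → v i ≤ w (ψ i)
    ψ-≤ zero    = v₀≤w₀
    ψ-≤ (suc i) = φ-≤ i

step⇒mono : (_≺_ : Rel A ℓ) → Transitive _≺_ → (g : ℕ → A) →
            (∀ n → g n ≺ g (suc n)) → ∀ {i j} → i ℕ.< j → g i ≺ g j
step⇒mono _≺_ ≺-trans g step i<j = go (ℕ.≤⇒≤′ i<j)
  where
  go : ∀ {i j} → suc i ≤′ j → g i ≺ g j
  go ≤′-refl     = step _
  go (≤′-step p) = ≺-trans (go p) (step _)

record AscendingSubsequence {A : Set a} (_≤_ : Rel A ℓ) (f : ℕ → A) : Set ℓ where
  field
    index     : ℕ → ℕ
    mono      : ∀ {i j} → i ℕ.< j → index i ℕ.< index j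
    ascending : ∀ {i j} → i ℕ.< j → f (index i) ≤ f (index j)

Good : Rel A ℓ → (ℕ → A) → Set ℓ
Good _≤_ f = ∃₂ λ i j → i ℕ.< j × f i ≤ f j

module _ {_≤_ : Rel A ℓ} where

  on-wqo : (f : B → A) → IsWellQuasiOrder _≤_ → IsWellQuasiOrder (_≤_ on f)
  on-wqo f ≤-wqo = record
    { isPreorder = record
      { isEquivalence = isEquivalence
      ; reflexive     = λ { refl → ≤-refl }
      ; trans         = ≤-trans
      }
    ; good       = λ g → good (f ∘ g)
    }
    where
    open IsWellQuasiOrder ≤-wqo
    open IsPreorder isPreorder using () renaming (refl to ≤-refl; trans to ≤-trans)

finite-wqo : (c : A → Fin k) → IsWellQuasiOrder (_≡_ on c)
finite-wqo {k = k} c = on-wqo c record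
  { isPreorder = record { isEquivalence = isEquivalence ; reflexive = id ; trans = trans }
  ; good       = λ f → let i , j , i<j , fᵢ≡fⱼ = Fin.pigeonhole (ℕ.n<1+n k) (f ∘ toℕ)
                       in toℕ i , toℕ j , i<j , fᵢ≡fⱼ
  }

-- Ascending subsequences and intersections of well-quasi-orders

module WQO (em : ∀ {p : Level} → ExcludedMiddle p) where

  module Ascending {_≤_ : Rel A ℓ} (≤-wqo : IsWellQuasiOrder _≤_) (f : ℕ → A) where

    open IsWellQuasiOrder ≤-wqo
    open IsPreorder isPreorder using () renaming (trans to ≤-trans)

    Continues : ℕ → Set ℓ
    Continues n = ∃[ m ] n ℕ.< m × f n ≤ f m

    -- Stuck indices occurring arbitrarily late would form a subsequence; a good pair in it would
    -- show that its first member is not stuck.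
    ¬frequently-stuck : ¬ (∀ k → ∃[ n ] k ℕ.≤ n × ¬ Continues n)
    ¬frequently-stuck stuck =
      let i , j , i<j , hᵢ≤hⱼ = good (f ∘ h)
      in  h-stuck i (h j , step⇒mono ℕ._<_ ℕ.<-trans h h-step i<j , hᵢ≤hⱼ)
      where
      h : ℕ → ℕ
      h zero    = proj₁ (stuck 0)
      h (suc i) = proj₁ (stuck (suc (h i)))

      h-step : ∀ i → h i ℕ.< h (suc i)
      h-step i = proj₁ (proj₂ (stuck (suc (h i))))

      h-stuck : ∀ i → ¬ Continues (h i)
      h-stuck zero    = proj₂ (proj₂ (stuck 0))
      h-stuck (suc i) = proj₂ (proj₂ (stuck (suc (h i))))

    eventually-continues : ∃[ k ] (∀ n → k ℕ.≤ n → Continues n)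
    eventually-continues = decidable-stable em λ ¬p → ¬frequently-stuck λ k →
      decidable-stable em λ ¬q → ¬p (k , λ n k≤n →
        decidable-stable em λ ¬c → ¬q (n , k≤n , ¬c))

    abstract
      subsequence : AscendingSubsequence _≤_ f
      subsequence = record
        { index     = index
        ; mono      = step⇒mono ℕ._<_ ℕ.<-trans index (λ i → proj₁ (proj₂ (continues i)))
        ; ascending = step⇒mono _≤_ ≤-trans (f ∘ index) (λ i → proj₂ (proj₂ (continues i)))
        }
        where
        start : ℕ
        start = proj₁ eventually-continues

        -- The bound is carried along because only indices from `start` on are known to continue.
        chain : ℕ → Σ[ n ∈ ℕ ] start ℕ.≤ n
        chain zero    = start , ℕ.≤-refl
        chain (suc i) =
          let n , s≤n     = chain i
              m , n<m , _ = proj₂ eventually-continues n s≤n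
          in  m , ℕ.≤-trans s≤n (ℕ.<⇒≤ n<m)

        continues : ∀ i → Continues (proj₁ (chain i))
        continues i = uncurry (proj₂ eventually-continues) (chain i)

        index : ℕ → ℕ
        index = proj₁ ∘ chain

  ∩-wqo : {_≤₁_ : Rel A ℓ} {_≤₂_ : Rel A ℓ′} →
          IsWellQuasiOrder _≤₁_ → IsWellQuasiOrder _≤₂_ → IsWellQuasiOrder (_≤₁_ ∩ʳ _≤₂_)
  ∩-wqo wqo₁ wqo₂ = record
    { isPreorder = record
      { isEquivalence = isEquivalence
      ; reflexive     = λ eq → P₁.reflexive eq , P₂.reflexive eq
      ; trans         = λ (p₁ , p₂) (q₁ , q₂) → P₁.trans p₁ q₁ , P₂.trans p₂ q₂
      }
    ; good       = λ f →
        -- Along a subsequence ascending for the first order, any pair that is good for the second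
        -- order is good for both.
        let open AscendingSubsequence (Ascending.subsequence wqo₁ f)
            i , j , i<j , f≤₂f = IsWellQuasiOrder.good wqo₂ (f ∘ index)
        in  index i , index j , mono i<j , ascending i<j , f≤₂f
    }
    where
    module P₁ = IsPreorder (IsWellQuasiOrder.isPreorder wqo₁)
    module P₂ = IsPreorder (IsWellQuasiOrder.isPreorder wqo₂)

  ⋂-wqo : (_≤[_]_ : A → Fin n → A → Set ℓ) → (∀ i → IsWellQuasiOrder (_≤[ i ]_)) →
          IsWellQuasiOrder (λ x y → ∀ i → x ≤[ i ] y)
  ⋂-wqo {n = zero} _ _ = record
    { isPreorder = record
      { isEquivalence = isEquivalence ; reflexive = λ _ () ; trans = λ _ _ () }
    ; good       = λ _ → 0 , 1 , ℕ.z<s , λ ()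
    }
  ⋂-wqo {n = suc n} _≤[_]_ wqo = record
    { isPreorder = record
      { isEquivalence = isEquivalence
      ; reflexive     = λ eq i → P.reflexive i eq
      ; trans         = λ p q i → P.trans i (p i) (q i)
      }
    ; good       = λ f →
        let i , j , i<j , p₀ , p = IsWellQuasiOrder.good
              (∩-wqo (wqo zero) (⋂-wqo (λ x k y → x ≤[ suc k ] y) (wqo ∘ suc))) f
        in  i , j , i<j , λ { zero → p₀ ; (suc k) → p k }
    }
    where
    module P i = IsPreorder (IsWellQuasiOrder.isPreorder (wqo i))

  minimal : (P : Pred A ℓ) (μ : A → ℕ) → ∃ P → ∃[ x ] P x × (∀ y → P y → μ x ℕ.≤ μ y)
  minimal P μ (x , px) = go x px (<-wellFounded (μ x))
    where
    go : ∀ x → P x → Acc ℕ._<_ (μ x) → ∃[ x ] P x × (∀ y → P y → μ x ℕ.≤ μ y)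
    go x px (acc rs) with em {P = ∃[ y ] P y × μ y ℕ.< μ x}
    ... | yes (y , py , y<x) = go y py (rs y<x)
    ... | no ¬smaller        = x , px , λ y py → ℕ.≮⇒≥ (λ y<x → ¬smaller (y , py , y<x))

  -- Minimal bad sequences, after Nash-Williams

  module MinimalBad {_≤_ : Rel A ℓ} (μ : A → ℕ) (f : ℕ → A) (f-bad : ¬ Good _≤_ f) where

    AgreesBelow : ℕ → Rel (ℕ → A) _
    AgreesBelow n g h = ∀ i → i ℕ.< n → g i ≡ h i

    BadBeyond : ℕ → (ℕ → A) → Pred (ℕ → A) _
    BadBeyond n g h = AgreesBelow n g h × ¬ Good _≤_ h

    improve : ∀ n g → ¬ Good _≤_ g →
              ∃[ h ] BadBeyond n g h × (∀ h′ → BadBeyond n g h′ → μ (h n) ℕ.≤ μ (h′ n))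
    improve n g g-bad = minimal (BadBeyond n g) (λ h → μ (h n)) (g , (λ _ _ → refl) , g-bad)

    approx : ℕ → ∃[ g ] ¬ Good _≤_ g
    approx zero    = f , f-bad
    approx (suc n) = let h , (_ , h-bad) , _ = improve n (proj₁ (approx n)) (proj₂ (approx n))
                     in  h , h-bad

    -- The entries of g n below n are final.
    g : ℕ → ℕ → A
    g = proj₁ ∘ approx

    g-step : ∀ n → AgreesBelow n (g n) (g (suc n))
    g-step n = proj₁ (proj₁ (proj₂ (improve n (g n) (proj₂ (approx n)))))

    g-agree : ∀ {m n} → m ≤′ n → AgreesBelow m (g m) (g n)
    g-agree ≤′-refl       _ _   = refl
    g-agree (≤′-step m≤n) i i<m =
      trans (g-agree m≤n i i<m) (g-step _ i (ℕ.<-≤-trans i<m (ℕ.≤′⇒≤ m≤n)))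

    -- Entry `n` is minimised in passing from stage `n` to stage `suc n`, hence the shift.
    limit : ℕ → A
    limit n = g (suc n) n

    limit-agree : ∀ n → AgreesBelow n (g n) limit
    limit-agree n i i<n = sym (g-agree (ℕ.≤⇒≤′ i<n) i (ℕ.n<1+n i))

    -- A good pair `i < j` of the limit would already be a good pair of `g (suc j)`, which has the
    -- same entries up to `j`.
    limit-bad : ¬ Good _≤_ limit
    limit-bad (i , j , i<j , p) = proj₂ (approx (suc j))
      (i , j , i<j , subst (_≤ limit j) (g-agree (ℕ.≤⇒≤′ (ℕ.s≤s (ℕ.<⇒≤ i<j))) i (ℕ.n<1+n i)) p)

    -- Agreeing with the limit below `n` means agreeing with `g n` there, so `h` is one of the
    -- competitors over which `improve` minimised entry `n`.
    limit-minimal : ∀ n h → AgreesBelow n limit h → ¬ Good _≤_ h → μ (limit n) ℕ.≤ μ (h n)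
    limit-minimal n h agree h-bad =
      proj₂ (proj₂ (improve n (g n) (proj₂ (approx n)))) h
        ((λ i i<n → trans (limit-agree n i i<n) (agree i i<n)) , h-bad)

  -- Higman's lemma

  module Higman
    {_≤_ : Rel A ℓ} (≤-wqo : IsWellQuasiOrder _≤_)
    (f : ℕ → Word A) (f-bad : ¬ Good (Embeds _≤_) f)
    (f-minimal : ∀ n h → (∀ i → i ℕ.< n → f i ≡ h i) → ¬ Good (Embeds _≤_) h →
                 Word.length (f n) ℕ.≤ Word.length (h n)) where

    open IsWellQuasiOrder ≤-wqo
    open IsPreorder isPreorder using () renaming (refl to ≤-refl; trans to ≤-trans)

    -- An empty word embeds into its successor, which a bad sequence forbids; so every word has a
    -- first letter.
    cons : ∀ i → ∃[ n ] Σ[ v ∈ Vector A (suc n) ] f i ≡ word v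
    cons i with f i in eq
    ... | word {zero}  v = contradiction
          (i , suc i , ℕ.n<1+n i ,
            subst (λ w → Embeds _≤_ w (f (suc i))) (sym eq) (embeds-empty v (f (suc i))))
          f-bad
    ... | word {suc n} v = n , v , refl

    first : ℕ → A
    first i = head (proj₁ (proj₂ (cons i)))

    rest : ℕ → Word A
    rest i = word (tail (proj₁ (proj₂ (cons i))))

    rest⊑f : ∀ i → Embeds _≤_ (rest i) (f i)
    rest⊑f i with cons i
    ... | n , v , eq = subst (Embeds _≤_ _) (sym eq) (embeds-tail ≤-refl v)

    cons⊑cons : ∀ i j → first i ≤ first j → Embeds _≤_ (rest i) (rest j) →
                Embeds _≤_ (f i) (f j)
    cons⊑cons i j p q with cons i | cons j
    ... | _ , v , eq | _ , w , eq′ =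
      subst₂ (Embeds _≤_) (sym eq) (sym eq′) (embeds-cons v w p q)

    rest-shorter : ∀ i → Word.length (rest i) ℕ.< Word.length (f i)
    rest-shorter i with cons i
    ... | n , v , eq = ℕ.≤-reflexive (cong Word.length (sym eq))

    open AscendingSubsequence (Ascending.subsequence ≤-wqo first)

    start : ℕ
    start = index 0

    -- From its start-th entry on, the sequence is replaced by the words with
    -- their first letters, which are ascending, deleted.
    splice : ∀ i → Dec (i ℕ.< start) → Word A
    splice i (yes _) = f i
    splice i (no  _) = rest (index (i ∸ start))

    spliced : ℕ → Word A
    spliced i = splice i (i ℕ.<? start)

    -- A good pair would lift to one of `f`: a word embedding into a shortened word embeds into the
    -- full one, and two shortened words regain their first letters, which ascend.
    spliced-bad : ¬ Good (Embeds _≤_) spliced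
    spliced-bad (i , j , i<j , p) with i ℕ.<? start | j ℕ.<? start
    ... | yes _   | yes _ = f-bad (i , j , i<j , p)
    ... | yes i<s | no  _ = f-bad
      ( i , index (j ∸ start)
      , ℕ.<-≤-trans i<s (start≤ (j ∸ start))
      , embeds-trans ≤-trans p (rest⊑f (index (j ∸ start)))
      )
      where
      start≤ : ∀ d → start ℕ.≤ index d
      start≤ zero    = ℕ.≤-refl
      start≤ (suc d) = ℕ.<⇒≤ (mono ℕ.z<s)
    ... | no i≮s  | yes j<s = i≮s (ℕ.<-trans i<j j<s)
    ... | no i≮s  | no  _   = f-bad
      (_ , _ , mono i′<j′ , cons⊑cons _ _ (ascending i′<j′) p)
      where
      i′<j′ : i ∸ start ℕ.< j ∸ start
      i′<j′ = ℕ.∸-monoˡ-< i<j (ℕ.≮⇒≥ i≮s)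

    spliced-agrees : ∀ i → i ℕ.< start → f i ≡ spliced i
    spliced-agrees i i<s with i ℕ.<? start
    ... | yes _  = refl
    ... | no i≮s = contradiction i<s i≮s

    spliced-start : spliced start ≡ rest start
    spliced-start with start ℕ.<? start
    ... | yes s<s = contradiction s<s (ℕ.<-irrefl refl)
    ... | no  _   = cong (rest ∘ index) (ℕ.n∸n≡0 start)

    -- The spliced sequence is bad and agrees with `f` below `start`, but its word at `start` is one
    -- letter shorter, against minimality.
    impossible : ⊥
    impossible = ℕ.<-irrefl refl
      (ℕ.≤-<-trans
        (subst (λ w → Word.length (f start) ℕ.≤ Word.length w) spliced-start
          (f-minimal start spliced spliced-agrees spliced-bad))
        (rest-shorter start))

  embeds-wqo : {_≤_ : Rel A ℓ} → IsWellQuasiOrder _≤_ → IsWellQuasiOrder (Embeds _≤_)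
  embeds-wqo ≤-wqo = record
    { isPreorder = embeds-isPreorder (IsWellQuasiOrder.isPreorder ≤-wqo)
    ; good       = λ f → decidable-stable em λ f-bad →
        let open MinimalBad {_≤_ = Embeds _} Word.length f f-bad
        in  Higman.impossible ≤-wqo limit limit-bad limit-minimal
    }

-- Cardinalities of subsets of Fin n

record Enumeration {A : Set a} (k : ℕ) (P : Pred A p) : Set (a ⊔ p) where
  field
    element    : Fin k → A
    injective  : Injective _≡_ _≡_ element
    sound      : ∀ i → P (element i)
    complete   : ∀ {x} → P x → ∃[ i ] element i ≡ x

-- Stated for positions in an arbitrary vector, since the tail of `allFin` is not again of that form
-- and the induction follows `count`.
enumerate-lookup : {P : Pred A p} (P? : Decidable P) (xs : Vec A n) →
                   Enumeration (count P? xs) (P ∘ lookup xs)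
enumerate-lookup P? [] = record
  { element = λ () ; injective = λ { {()} } ; sound = λ () ; complete = λ { {()} } }
enumerate-lookup {P = P} P? (x ∷ xs) with P? x | enumerate-lookup P? xs
... | yes px | e = record
  { element   = element⁺
  ; injective = injective⁺
  ; sound     = sound⁺
  ; complete  = complete⁺
  }
  where
  open Enumeration e

  element⁺ : Fin (suc _) → Fin (suc _)
  element⁺ zero    = zero
  element⁺ (suc i) = suc (element i)

  injective⁺ : Injective _≡_ _≡_ element⁺
  injective⁺ {zero}  {zero}  _  = refl
  injective⁺ {zero}  {suc _} ()
  injective⁺ {suc _} {zero}  ()
  injective⁺ {suc _} {suc _} eq = cong suc (injective (Fin.suc-injective eq))

  sound⁺ : ∀ i → P (lookup (x ∷ xs) (element⁺ i))
  sound⁺ zero    = px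
  sound⁺ (suc i) = sound i

  complete⁺ : ∀ {i} → P (lookup (x ∷ xs) i) → ∃[ j ] element⁺ j ≡ i
  complete⁺ {zero}  _ = zero , refl
  complete⁺ {suc i} q = let j , eq = complete q in suc j , cong suc eq
... | no ¬px | e = record
  { element   = suc ∘ element
  ; injective = injective ∘ Fin.suc-injective
  ; sound     = sound
  ; complete  = complete⁺
  }
  where
  open Enumeration e

  complete⁺ : ∀ {i} → P (lookup (x ∷ xs) i) → ∃[ j ] suc (element j) ≡ i
  complete⁺ {zero}  q = contradiction q ¬px
  complete⁺ {suc i} q = let j , eq = complete q in j , cong suc eq

enumerate : {P : Pred (Fin n) p} (P? : Decidable P) → Enumeration (count P? (allFin n)) P
enumerate {P = P} P? = record
  { element   = element
  ; injective = injective
  ; sound     = λ i → subst P (lookup-allFin (element i)) (sound i)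
  ; complete  = λ {x} px → complete (subst P (sym (lookup-allFin x)) px)
  }
  where open Enumeration (enumerate-lookup P? (allFin _))

module _ {P : Pred (Fin m) p} {Q : Pred (Fin n) q} (P? : Decidable P) (Q? : Decidable Q) where

  -- The map receives the membership proof, so it needs to be defined on `P` only.
  count-≤ : (f : ∀ {x} → P x → Fin n) → (∀ {x} (px : P x) → Q (f px)) →
            (∀ {x y} (px : P x) (py : P y) → f px ≡ f py → x ≡ y) →
            count P? (allFin m) ℕ.≤ count Q? (allFin n)
  count-≤ f f-Q f-inj = Fin.injective⇒≤ {f = λ i → proj₁ (position i)} λ {i} {j} eq →
    P.injective (f-inj (P.sound i) (P.sound j)
      (trans (sym (proj₂ (position i))) (trans (cong Q.element eq) (proj₂ (position j)))))
    where
    module P = Enumeration (enumerate P?)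
    module Q = Enumeration (enumerate Q?)

    position : ∀ i → ∃[ j ] Q.element j ≡ f (P.sound i)
    position i = Q.complete (f-Q (P.sound i))

count-split : {P : Pred A p} {Q R : Pred A q}
              (P? : Decidable P) (Q? : Decidable Q) (R? : Decidable R) →
              (∀ {x} → P x → ¬ R x → Q x) → (∀ {x} → Q x → P x × ¬ R x) → (∀ {x} → R x → P x) →
              (xs : Vec A n) → count P? xs ≡ count Q? xs + count R? xs
count-split P? Q? R? p¬r⇒q q⇒p¬r r⇒p []       = refl
count-split P? Q? R? p¬r⇒q q⇒p¬r r⇒p (x ∷ xs)
  with P? x | Q? x | R? x | count-split P? Q? R? p¬r⇒q q⇒p¬r r⇒p xs
... | yes _  | yes _  | no _   | eq = cong suc eq
... | yes _  | no _   | yes _  | eq = trans (cong suc eq) (sym (ℕ.+-suc _ _))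
... | no _   | no _   | no _   | eq = eq
... | _      | yes q  | yes r  | _  = contradiction r (proj₂ (q⇒p¬r q))
... | yes p  | no ¬q  | no ¬r  | _  = contradiction (p¬r⇒q p ¬r) ¬q
... | no ¬p  | yes q  | no _   | _  = contradiction (proj₁ (q⇒p¬r q)) ¬p
... | no ¬p  | no _   | yes r  | _  = contradiction (r⇒p r) ¬p

module Counting (em : ∀ {p : Level} → ExcludedMiddle p) where

  -- Abstract so that unification recovers P from size P.
  abstract
    size : Pred (Fin n) p → ℕ
    size {n = n} P = count (λ x → em {P = P x}) (allFin n)

    size-≤n : (P : Pred (Fin n) p) → size P ℕ.≤ n
    size-≤n {n = n} P = count≤n (λ _ → em) (allFin n)

    enumerate-size : (P : Pred (Fin n) p) → Enumeration (size P) P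
    enumerate-size P = enumerate (λ _ → em)

    size-≤ : {P : Pred (Fin m) p} {Q : Pred (Fin n) q} →
             (f : ∀ {x} → P x → Fin n) → (∀ {x} (px : P x) → Q (f px)) →
             (∀ {x y} (px : P x) (py : P y) → f px ≡ f py → x ≡ y) → size P ℕ.≤ size Q
    size-≤ = count-≤ (λ _ → em) (λ _ → em)

    -- Links degrees, which are counted with the graph's own decision procedure, to sizes, which are
    -- counted with `em`.
    count≡size : {P : Pred (Fin n) p} (P? : Decidable P) → count P? (allFin n) ≡ size P
    count≡size P? = ℕ.≤-antisym
      (count-≤ P? (λ _ → em) (λ {x} _ → x) id (λ _ _ → id))
      (count-≤ (λ _ → em) P? (λ {x} _ → x) id (λ _ _ → id))

    size-split : (P Q : Pred (Fin n) p) → size P ≡ size (P ∩ Q) + size (P ∩ ∁ Q)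
    size-split {n = n} P Q =
      count-split {P = P} {P ∩ Q} {P ∩ ∁ Q} (λ _ → em) (λ _ → em) (λ _ → em)
        (λ px ¬r → px , decidable-stable em λ ¬qx → ¬r (px , ¬qx))
        (λ (px , qx) → px , λ (_ , ¬qx) → ¬qx qx)
        proj₁
        (allFin n)

  size-image : {P : Pred (Fin m) p} {Q : Pred (Fin n) q}
               (f : Fin m → Fin n) → Injective _≡_ _≡_ f →
               (∀ {x} → P x → Q (f x)) → (∀ {y} → Q y → ∃[ x ] f x ≡ y × P x) → size P ≡ size Q
  size-image f f-inj P⇒Q Q⇒P = ℕ.≤-antisym
    (size-≤ (λ {x} _ → f x) P⇒Q (λ _ _ → f-inj))
    (size-≤ (proj₁ ∘ Q⇒P) (λ qy → proj₂ (proj₂ (Q⇒P qy)))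
      (λ qy qy′ eq → trans (sym (proj₁ (proj₂ (Q⇒P qy))))
        (trans (cong f eq) (proj₁ (proj₂ (Q⇒P qy′))))))

  size-cong : {P : Pred (Fin n) p} {Q : Pred (Fin n) q} →
              (∀ {x} → P x → Q x) → (∀ {x} → Q x → P x) → size P ≡ size Q
  size-cong P⊆Q Q⊆P = size-image id id P⊆Q (λ qx → _ , refl , Q⊆P qx)

  size-U : size {n = n} U ≡ n
  size-U {n = n} = ℕ.≤-antisym (size-≤n U)
    (Fin.injective⇒≤ {f = position} λ {i} {j} eq →
      trans (sym (proj₂ (complete tt))) (trans (cong element eq) (proj₂ (complete tt))))
    where
    open Enumeration (enumerate-size {n = n} U)

    position : Fin n → Fin (size {n = n} U)
    position i = proj₁ (complete {i} tt)

  -- Disjoint unions of cliques of equal size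

  record CliquePartition (s : ℕ) (P : Pred (Fin n) 0ℓ) : Set₁ where
    field
      _~_         : Rel (Fin n) 0ℓ
      irreflexive : Irreflexive _≡_ _~_
      symmetric   : Symmetric _~_
      support     : ∀ {x y} → x ~ y → P x
      degree      : ∀ {x} → P x → size (x ~_) ≡ s

  -- The enumeration of `P` is cut by `combine` into `q` blocks of `s + 1` members; distinct members
  -- of a block are adjacent.
  cliquePartition : {s : ℕ} {P : Pred (Fin n) 0ℓ} → suc s ∣ size P → CliquePartition s P
  cliquePartition {n = n} {s = s} {P = P} (divides q size≡) = record
    { _~_         = _~_
    ; irreflexive = λ { {x} refl (b , i , j , x≡ , y≡ , i≢j) →
                          i≢j (proj₂ (member-injective (trans x≡ (sym y≡)))) }
    ; symmetric   = λ (b , i , j , x≡ , y≡ , i≢j) → b , j , i , y≡ , x≡ , i≢j ∘ sym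
    ; support     = λ (b , i , _ , x≡ , _) → subst P x≡ (member-sound b i)
    ; degree      = degree
    }
    where
    e : Enumeration (q * suc s) P
    e = subst (λ k → Enumeration k P) size≡ (enumerate-size P)
    open Enumeration e

    member : Fin q → Fin (suc s) → Fin n
    member b i = element (combine b i)

    member-sound : ∀ b i → P (member b i)
    member-sound b i = sound (combine b i)

    member-injective : ∀ {b c i j} → member b i ≡ member c j → b ≡ c × i ≡ j
    member-injective {b} {c} {i} {j} = Fin.combine-injective b i c j ∘ injective

    member-complete : ∀ {x} → P x → ∃₂ λ b i → member b i ≡ x
    member-complete px =
      let k , k≡ = complete px
          b , i , bi≡k = Fin.combine-surjective {q} {suc s} k
      in  b , i , trans (cong element bi≡k) k≡

    _~_ : Rel (Fin n) 0ℓ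
    x ~ y = Σ[ b ∈ Fin q ] ∃₂ λ i j → member b i ≡ x × member b j ≡ y × i ≢ j

    degree : ∀ {x} → P x → size (x ~_) ≡ s
    degree {x} px with member-complete px
    -- The neighbours are the other members of block `b`, and `punchIn i` lists their `s` positions.
    ... | b , i , refl = trans (sym (size-image (member b ∘ punchIn i)
        (Fin.punchIn-injective i _ _ ∘ proj₂ ∘ member-injective)
        (λ {k} _ → b , i , punchIn i k , refl , refl , Fin.punchInᵢ≢i i k ∘ sym)
        λ (c , i′ , j , x≡ , y≡ , i′≢j) → back c i′ j (member-injective x≡) y≡ i′≢j))
      size-U
      where
      back : ∀ c i′ j {y} → c ≡ b × i′ ≡ i → member c j ≡ y → i′ ≢ j →
             ∃[ k ] member b (punchIn i k) ≡ y × U k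
      back c i′ j (refl , refl) y≡ i≢j =
        punchOut i≢j , trans (cong (member b) (Fin.punchIn-punchOut i≢j)) y≡ , tt

-- Realizations of degree sequences

-- Cancelling the common remainder leaves `m / d * d + n ≡ (m + n) / d * d`.
%-≡⇒∣ : ∀ m n d .{{_ : ℕ.NonZero d}} → m % d ≡ (m + n) % d → d ∣ n
%-≡⇒∣ m n d eq = ∣m+n∣m⇒∣n (divides ((m + n) / d) (ℕ.+-cancelˡ-≡ (m % d) _ _ (begin
  m % d + (m / d * d + n)           ≡⟨ ℕ.+-assoc (m % d) _ n ⟨
  m % d + m / d * d + n             ≡⟨ cong (_+ n) (m≡m%n+[m/n]*n m d) ⟨
  m + n                             ≡⟨ m≡m%n+[m/n]*n (m + n) d ⟩
  (m + n) % d + (m + n) / d * d     ≡⟨ cong (_+ (m + n) / d * d) eq ⟨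
  m % d + (m + n) / d * d           ∎)))
  (divides (m / d) refl)
  where open ≡-Reasoning

mod-≡⇒%-≡ : ∀ m n d .{{_ : ℕ.NonZero d}} → m mod d ≡ n mod d → m % d ≡ n % d
mod-≡⇒%-≡ m n d eq = trans (sym (Fin.toℕ-fromℕ< (m%n<n m d)))
  (trans (cong toℕ eq) (Fin.toℕ-fromℕ< (m%n<n n d)))

module Graphs (em : ∀ {p : Level} → ExcludedMiddle p) where

  open Counting em

  module _ (G : Graph) (Core : Pred (Graph.Vertex G) 0ℓ) where

    open Graph G

    outerDegree : Vertex → ℕ
    outerDegree v = size ((v ~_) ∩ ∁ Core)

    OfOuterDegree : ℕ → Pred Vertex 0ℓ
    OfOuterDegree s v = ¬ Core v × outerDegree v ≡ s

    outerDegree≤degree : ∀ v → outerDegree v ℕ.≤ degree v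
    outerDegree≤degree v = subst (outerDegree v ℕ.≤_) (sym (count≡size (v ~?_)))
      (size-≤ (λ {x} _ → x) proj₁ (λ _ _ → id))

  -- Rewiring the larger graph outside the core

  module Rewiring
    (G H : Graph)
    (CoreG : Pred (Graph.Vertex G) 0ℓ) (CoreH : Pred (Graph.Vertex H) 0ℓ)
    (φ : Graph.Vertex G → Graph.Vertex H) (φ-injective : Injective _≡_ _≡_ φ)
    (core⁺ : ∀ {u} → CoreG u → CoreH (φ u))
    (core⁻ : ∀ {u} → CoreH (φ u) → CoreG u)
    (core-~⁺ : ∀ {u v} → CoreG u → Graph._~_ G u v → Graph._~_ H (φ u) (φ v))
    (core-~⁻ : ∀ {u v} → CoreG u → Graph._~_ H (φ u) (φ v) → Graph._~_ G u v)
    (outer-≡ : ∀ {u} → ¬ CoreG u → outerDegree G CoreG u ≡ outerDegree H CoreH (φ u))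
    (N : ℕ)
    (outer-≤ : ∀ {w} → ¬ CoreH w → outerDegree H CoreH w ℕ.≤ N)
    (residue-≡ : ∀ (s : Fin (suc N)) →
       size (OfOuterDegree G CoreG (toℕ s)) % suc (toℕ s) ≡
       size (OfOuterDegree H CoreH (toℕ s)) % suc (toℕ s))
    where

    module G = Graph G
    module H = Graph H

    Image : Pred H.Vertex 0ℓ
    Image w = ∃[ u ] φ u ≡ w

    Remaining : ℕ → Pred H.Vertex 0ℓ
    Remaining s = OfOuterDegree H CoreH s ∩ ∁ Image

    -- Since `φ` matches the vertices of outer degree `s` in `G` with those of `H` in the image, the
    -- number remaining is the difference of two counts congruent mod `s + 1`.
    remaining-divisible : ∀ (s : Fin (suc N)) → suc (toℕ s) ∣ size (Remaining (toℕ s))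
    remaining-divisible s =
      %-≡⇒∣ (size (OfOuterDegree G CoreG (toℕ s))) _ (suc (toℕ s))
        (trans (residue-≡ s) (cong (_% suc (toℕ s)) (begin
          size OfH                                ≡⟨ size-split OfH Image ⟩
          size (OfH ∩ Image) + size (OfH ∩ ∁ Image)
            ≡⟨ cong (_+ size (OfH ∩ ∁ Image)) (size-image φ φ-injective to from) ⟨
          size OfG + size (OfH ∩ ∁ Image)         ∎)))
      where
      open ≡-Reasoning
      OfG = OfOuterDegree G CoreG (toℕ s)
      OfH = OfOuterDegree H CoreH (toℕ s)

      to : ∀ {u} → OfG u → (OfH ∩ Image) (φ u)
      to (¬c , eq) = (¬c ∘ core⁻ , trans (sym (outer-≡ ¬c)) eq) , _ , refl

      from : ∀ {w} → (OfH ∩ Image) w → ∃[ u ] φ u ≡ w × OfG u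
      from ((¬c , eq) , u , refl) = u , refl , ¬c ∘ core⁺ , trans (outer-≡ (¬c ∘ core⁺)) eq

    cliques : ∀ (s : Fin (suc N)) → CliquePartition (toℕ s) (Remaining (toℕ s))
    cliques s = cliquePartition (remaining-divisible s)

    module Clique s = CliquePartition (cliques s)

    data Outer : Rel H.Vertex 0ℓ where
      image  : ∀ {u v} → ¬ CoreG u → ¬ CoreG v → u G.~ v → Outer (φ u) (φ v)
      clique : ∀ s {w w′} → Clique._~_ s w w′ → Outer w w′

    outer-sym : Symmetric Outer
    outer-sym (image ¬c ¬c′ e) = image ¬c′ ¬c (G.symmetric e)
    outer-sym (clique s e)     = clique s (Clique.symmetric s e)

    outer-irrefl′ : ∀ {w w′} → Outer w w′ → w ≢ w′
    outer-irrefl′ (image _ _ e) eq = G.irreflexive (φ-injective eq) e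
    outer-irrefl′ (clique s e)  eq = Clique.irreflexive s eq e

    outer-∁core : ∀ {w w′} → Outer w w′ → ¬ CoreH w
    outer-∁core (image ¬c _ _) = ¬c ∘ core⁻
    outer-∁core (clique s e)   = proj₁ (proj₁ (Clique.support s e))

    -- The cliques avoid the image, so an edge at `φ u` can only come from `G`. The helper replaces
    -- `φ u` by a variable and an equation so that the edge can be matched on.
    outer-image⁻ : ∀ {u w} → Outer (φ u) w → ∃[ v ] φ v ≡ w × u G.~ v × ¬ CoreG v
    outer-image⁻ {u} o = go o refl
      where
      go : ∀ {w w′} → Outer w w′ → φ u ≡ w → ∃[ v ] φ v ≡ w′ × u G.~ v × ¬ CoreG v
      go (image {u′} {v} _ ¬c e) eq = v , refl , subst (G._~ v) (sym (φ-injective eq)) e , ¬c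
      go (clique s e) eq            = contradiction (u , eq) (proj₂ (Clique.support s e))

    -- On the image the neighbours are copied from `G`, where the outer degree is the same; off the
    -- image they form the rest of the clique assigned to the outer degree of `w`.
    size-outer : ∀ {w} → ¬ CoreH w → size (Outer w) ≡ outerDegree H CoreH w
    size-outer {w} ¬c with em {P = Image w}
    ... | yes (u , refl) = trans
      (sym (size-image φ φ-injective (λ (e , ¬c′) → image (¬c ∘ core⁺) ¬c′ e) outer-image⁻))
      (outer-≡ (¬c ∘ core⁺))
    ... | no ∉image = trans
      (size-cong (λ o → same o ∉image) (clique s))
      (trans (Clique.degree s ((¬c , sym s≡) , ∉image)) s≡)
      where
      s : Fin (suc N)
      s = fromℕ< (ℕ.s≤s (outer-≤ ¬c))

      s≡ : toℕ s ≡ outerDegree H CoreH w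
      s≡ = Fin.toℕ-fromℕ< (ℕ.s≤s (outer-≤ ¬c))

      same : ∀ {w′} → Outer w w′ → ¬ Image w → Clique._~_ s w w′
      same (image _ _ _) ∉image = contradiction (_ , refl) ∉image
      -- A clique edge of index `s′` at `w` forces the outer degree of `w` to be `s′`, so `s′` is
      -- `s`.
      same (clique s′ e) _      = subst (λ s → Clique._~_ s w _)
        (Fin.toℕ-injective (trans (sym (proj₂ (proj₁ (Clique.support s′ e)))) (sym s≡))) e

    data Rewired (w w′ : H.Vertex) : Set where
      inner : CoreH w ⊎ CoreH w′ → w H.~ w′ → Rewired w w′
      outer : Outer w w′ → Rewired w w′

    rewired-sym : Symmetric Rewired
    rewired-sym (inner (inj₁ c) e) = inner (inj₂ c) (H.symmetric e)
    rewired-sym (inner (inj₂ c) e) = inner (inj₁ c) (H.symmetric e)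
    rewired-sym (outer o)          = outer (outer-sym o)

    rewired : Graph
    rewired = record
      { order       = H.order
      ; _~_         = Rewired
      ; _~?_        = λ _ _ → em
      ; irreflexive = λ { eq (inner _ e) → H.irreflexive eq e
                        ; eq (outer o)   → outer-irrefl′ o eq }
      ; symmetric   = rewired-sym
      }

    -- Neighbours in the core are untouched. Outside the core, a core vertex keeps its neighbours,
    -- and any other vertex gets equally many by `size-outer`.
    rewired-degree : ∀ w → Graph.degree rewired w ≡ H.degree w
    rewired-degree w = begin
      Graph.degree rewired w
        ≡⟨ count≡size {P = Rewired w} (λ _ → em) ⟩
      size (Rewired w)
        ≡⟨ size-split (Rewired w) CoreH ⟩
      size (Rewired w ∩ CoreH) + size (Rewired w ∩ ∁ CoreH)
        ≡⟨ cong₂ _+_ core-part (outer-part em) ⟩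
      size ((w H.~_) ∩ CoreH) + size ((w H.~_) ∩ ∁ CoreH)
        ≡⟨ size-split (w H.~_) CoreH ⟨
      size (w H.~_)
        ≡⟨ count≡size (w H.~?_) ⟨
      H.degree w ∎
      where
      open ≡-Reasoning

      core-part : size (Rewired w ∩ CoreH) ≡ size ((w H.~_) ∩ CoreH)
      core-part = size-cong
        (λ { (inner _ e , c) → e , c
           ; (outer o , c)   → contradiction c (outer-∁core (outer-sym o)) })
        (λ (e , c) → inner (inj₂ c) e , c)

      outer-part : Dec (CoreH w) → size (Rewired w ∩ ∁ CoreH) ≡ size ((w H.~_) ∩ ∁ CoreH)
      outer-part (yes c) = size-cong
        (λ { (inner _ e , ¬c) → e , ¬c ; (outer o , _) → contradiction c (outer-∁core o) })
        (λ (e , ¬c) → inner (inj₁ c) e , ¬c)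
      outer-part (no ¬c) = trans
        (size-cong
          (λ { (inner (inj₁ c) _ , _)   → contradiction c ¬c
             ; (inner (inj₂ c) _ , ¬c′) → contradiction c ¬c′
             ; (outer o , _)            → o })
          (λ o → outer o , outer-∁core (outer-sym o)))
        (size-outer ¬c)

    -- Edges meeting the core are those of `H`, on which `φ` is faithful by hypothesis; the others
    -- within the image were copied from `G`.
    rewired-induced : ∀ u v → (u G.~ v) ⇔ Rewired (φ u) (φ v)
    rewired-induced u v = mk⇔ to from
      where
      to : u G.~ v → Rewired (φ u) (φ v)
      to e with em {P = CoreG u} | em {P = CoreG v}
      ... | yes c | _      = inner (inj₁ (core⁺ c)) (core-~⁺ c e)
      ... | no _  | yes c  = inner (inj₂ (core⁺ c)) (H.symmetric (core-~⁺ c (G.symmetric e)))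
      ... | no ¬c | no ¬c′ = outer (image ¬c ¬c′ e)

      from : Rewired (φ u) (φ v) → u G.~ v
      from (inner (inj₁ c) e) = core-~⁻ (core⁻ c) e
      from (inner (inj₂ c) e) = G.symmetric (core-~⁻ (core⁻ c) (H.symmetric e))
      from (outer o) =
        let v′ , eq , e , _ = outer-image⁻ o in subst (u G.~_) (φ-injective eq) e

  -- Turns a proposition into a colour from a finite set, so that `finite-wqo` applies to it.
  bit : {p : Level} → Set p → Fin 2
  bit P = if does (em {P = P}) then suc zero else zero

  bit-transfer : {p : Level} {P P′ : Set p} → bit P ≡ bit P′ → P → P′
  bit-transfer {P = P} {P′} eq p with em {P = P} | em {P = P′}
  ... | _      | yes p′ = p′
  ... | no ¬p  | no _   = contradiction p ¬p
  bit-transfer () p | yes _ | no _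

  -- The core of a realization

  module Realization {Q : Set a} (N : ℕ) (D : LabelledGraphicSequence Q) where

    open LabelledGraphicSequence D
    open IsGraphic isGraphic

    graph : Graph
    graph = proj₁ realizable

    open Graph graph

    place : Fin length → Vertex
    place = proj₁ (proj₂ realizable)

    place-bijective : Bijective _≡_ _≡_ place
    place-bijective = proj₁ (proj₂ (proj₂ realizable))

    degree-place : ∀ i → degree (place i) ≡ degrees i
    degree-place = proj₂ (proj₂ (proj₂ realizable))

    index : Vertex → Fin length
    index v = proj₁ (proj₂ place-bijective v)

    place-index : ∀ v → place (index v) ≡ v
    place-index v = proj₂ (proj₂ place-bijective v) refl

    index-place : ∀ i → index (place i) ≡ i
    index-place i = proj₁ place-bijective (place-index (place i))

    index-injective : Injective _≡_ _≡_ index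
    index-injective {v} {w} eq =
      trans (sym (place-index v)) (trans (cong place eq) (place-index w))

    label : Vertex → Q
    label = labels ∘ index

    -- Positions are compared through `toℕ` because `length` may be less than `N`; a position may
    -- then be vacant.
    At : Fin N → Pred Vertex 0ℓ
    At p v = toℕ (index v) ≡ toℕ p

    At-unique : ∀ {p v w} → At p v → At p w → v ≡ w
    At-unique v≡ w≡ = index-injective (Fin.toℕ-injective (trans v≡ (sym w≡)))

    Adjacent : Fin N → Pred Vertex 0ℓ
    Adjacent p v = ∃[ u ] At p u × u ~ v

    -- As the degrees are sorted, the first N vertices include all those of
    -- degree greater than N.
    Core : Pred Vertex 0ℓ
    Core v = ∃[ p ] At p v

    -- If an entry at index at least `N` exceeded `N`, then by sortedness so would the `N + 1`
    -- entries with indices `0` to `N`, one more than allowed.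
    degrees-≤ : #entries> N ℕ.≤ N → ∀ i → N ℕ.≤ toℕ i → degrees i ℕ.≤ N
    degrees-≤ few i N≤i = ℕ.≮⇒≥ λ N<dᵢ → ℕ.<⇒≱ (ℕ.n<1+n N) (begin
      suc N                              ≡⟨ size-U ⟨
      size {n = suc N} U                 ≤⟨ size-≤ {P = U} {Q = λ j → N ℕ.< degrees j}
                                              (λ {j} _ → initial j) (λ {j} _ → large N<dᵢ j)
                                              (λ _ _ → Fin.inject≤-injective _ _ _ _) ⟩
      size (λ j → N ℕ.< degrees j)       ≡⟨ count≡size (λ j → N ℕ.<? degrees j) ⟨
      #entries> N                        ≤⟨ few ⟩
      N                                  ∎)
      where
      open ℕ.≤-Reasoning
      N<length : suc N ℕ.≤ length
      N<length = ℕ.≤-<-trans N≤i (Fin.toℕ<n i)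

      initial : Fin (suc N) → Fin length
      initial j = inject≤ j N<length

      large : N ℕ.< degrees i → ∀ j → N ℕ.< degrees (initial j)
      large N<dᵢ j = ℕ.<-≤-trans N<dᵢ (nonincreasing (initial j) i (begin
        toℕ (initial j)   ≡⟨ Fin.toℕ-inject≤ j N<length ⟩
        toℕ j             ≤⟨ Fin.toℕ≤pred[n] j ⟩
        N                 ≤⟨ N≤i ⟩
        toℕ i             ∎))

    outerDegree-≤ : #entries> N ℕ.≤ N → ∀ {v} → ¬ Core v → outerDegree graph Core v ℕ.≤ N
    outerDegree-≤ few {v} ¬c = begin
      outerDegree graph Core v    ≤⟨ outerDegree≤degree graph Core v ⟩
      degree v                    ≡⟨ cong degree (place-index v) ⟨
      degree (place (index v))    ≡⟨ degree-place (index v) ⟩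
      degrees (index v)           ≤⟨ degrees-≤ few (index v) (ℕ.≮⇒≥ λ i<N →
                                       ¬c (fromℕ< i<N , sym (Fin.toℕ-fromℕ< i<N))) ⟩
      N                           ∎
      where open ℕ.≤-Reasoning

  open WQO em

  -- The well-quasi-order on labelled graphic sequences

  module SequenceWQO {Q : Set a} (_≤_ : Rel Q ℓ) (≤-wqo : IsWellQuasiOrder _≤_) (N : ℕ) where

    module R (D : LabelledGraphicSequence Q) = Realization N D

    -- Vertices of all realizations are gathered in one type, so that each sequence becomes a word
    -- over a single alphabet.
    Point : Set _
    Point = ∃ λ D → Graph.Vertex (R.graph D)

    atBit adjacentBit : Fin N → Point → Fin 2
    atBit p (D , v)       = bit (R.At D p v)
    adjacentBit p (D , v) = bit (R.Adjacent D p v)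

    -- The reduction mod `N + 1` makes the range finite and loses nothing outside the core, where
    -- outer degrees are at most `N` when at most `N` entries exceed `N`.
    outer : Point → Fin (suc N)
    outer (D , v) = outerDegree (R.graph D) (R.Core D) v mod suc N

    labelOf : Point → Q
    labelOf (D , v) = R.label D v

    _≼_ : Rel Point ℓ
    _≼_ = (λ x y → ∀ p → atBit p x ≡ atBit p y)
       ∩ʳ (λ x y → ∀ p → adjacentBit p x ≡ adjacentBit p y)
       ∩ʳ (_≡_ on outer)
       ∩ʳ (_≤_ on labelOf)

    ≼-wqo : IsWellQuasiOrder _≼_
    ≼-wqo = ∩-wqo (∩-wqo (∩-wqo
      (⋂-wqo (λ x p y → atBit p x ≡ atBit p y) (λ p → finite-wqo (atBit p)))
      (⋂-wqo (λ x p y → adjacentBit p x ≡ adjacentBit p y) (λ p → finite-wqo (adjacentBit p))))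
      (finite-wqo outer))
      (on-wqo labelOf ≤-wqo)

    residue : (s : Fin (suc N)) → LabelledGraphicSequence Q → Fin (suc (toℕ s))
    residue s D = size (OfOuterDegree (R.graph D) (R.Core D) (toℕ s)) mod suc (toℕ s)

    points : LabelledGraphicSequence Q → Word Point
    points D = word (λ v → D , v)

    _⊑_ : Rel (LabelledGraphicSequence Q) ℓ
    _⊑_ = (λ D D′ → ∀ s → residue s D ≡ residue s D′) ∩ʳ (Embeds _≼_ on points)

    ⊑-wqo : IsWellQuasiOrder _⊑_
    ⊑-wqo = ∩-wqo
      (⋂-wqo (λ D s D′ → residue s D ≡ residue s D′) (λ s → finite-wqo (residue s)))
      (on-wqo points (embeds-wqo ≼-wqo))

    -- `D` keeps its given realization. That of `D′` is rewired; vertices, labels and placement stay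
    -- valid because all degrees are preserved.
    ⊑⇒SequenceOrder : ∀ {D D′} → LabelledGraphicSequence.#entries> D N ℕ.≤ N →
                      LabelledGraphicSequence.#entries> D′ N ℕ.≤ N →
                      D ⊑ D′ → SequenceOrder _≤_ D D′
    ⊑⇒SequenceOrder {D} {D′} few few′ (residue-≡ , embedding φ φ-injective φ-≼) =
        record { graph = G.graph ; label = G.label }
      , record { graph = rewired ; label = H.label }
      , (G.place , G.place-bijective ,
          λ i → G.degree-place i , cong G.labels (G.index-place i))
      , (H.place , H.place-bijective ,
          λ i → trans (rewired-degree (H.place i)) (H.degree-place i) ,
                cong H.labels (H.index-place i))
      , (φ , φ-injective , rewired-induced , λ u → proj₂ (φ-≼ u))
      where
      module G where
        open Realization N D public
        open LabelledGraphicSequence D public using (labels)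
        open Graph graph public
      module H where
        open Realization N D′ public
        open LabelledGraphicSequence D′ public using (labels)
        open Graph graph public

      at⁺ : ∀ {p u} → G.At p u → H.At p (φ u)
      at⁺ {p} {u} = bit-transfer (proj₁ (proj₁ (proj₁ (φ-≼ u))) p)

      at⁻ : ∀ {p u} → H.At p (φ u) → G.At p u
      at⁻ {p} {u} = bit-transfer (sym (proj₁ (proj₁ (proj₁ (φ-≼ u))) p))

      core-~⁺ : ∀ {u v} → G.Core u → u G.~ v → φ u H.~ φ v
      core-~⁺ {u} {v} (p , atu) e =
        -- The data of `φ v` only names the position of a neighbour; as a position determines its
        -- vertex, that neighbour is `φ u`.
        let w , atw , e′ = bit-transfer (proj₂ (proj₁ (proj₁ (φ-≼ v))) p) (u , atu , e)
        in  subst (H._~ φ v) (H.At-unique {p} atw (at⁺ {p} atu)) e′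

      core-~⁻ : ∀ {u v} → G.Core u → φ u H.~ φ v → u G.~ v
      core-~⁻ {u} {v} (p , atu) e =
        let w , atw , e′ = bit-transfer (sym (proj₂ (proj₁ (proj₁ (φ-≼ v))) p))
                             (φ u , at⁺ {p} atu , e)
        in  subst (G._~ v) (G.At-unique {p} atw atu) e′

      core⁺ : ∀ {u} → G.Core u → H.Core (φ u)
      core⁺ (p , atu) = p , at⁺ {p} atu

      core⁻ : ∀ {u} → H.Core (φ u) → G.Core u
      core⁻ (p , at) = p , at⁻ {p} at

      outer-≡ : ∀ {u} → ¬ G.Core u →
                outerDegree G.graph G.Core u ≡ outerDegree H.graph H.Core (φ u)
      outer-≡ {u} ¬c = begin
        dG             ≡⟨ m≤n⇒m%n≡m (G.outerDegree-≤ few ¬c) ⟨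
        dG % suc N     ≡⟨ mod-≡⇒%-≡ dG dH (suc N) (proj₂ (proj₁ (φ-≼ u))) ⟩
        dH % suc N     ≡⟨ m≤n⇒m%n≡m (H.outerDegree-≤ few′ (¬c ∘ core⁻)) ⟩
        dH             ∎
        where
        open ≡-Reasoning
        dG = outerDegree G.graph G.Core u
        dH = outerDegree H.graph H.Core (φ u)

      open Rewiring G.graph H.graph G.Core H.Core φ φ-injective
        core⁺ core⁻ core-~⁺ core-~⁻ outer-≡ N (H.outerDegree-≤ few′)
        (λ s → mod-≡⇒%-≡ (size (OfOuterDegree G.graph G.Core (toℕ s)))
                         (size (OfOuterDegree H.graph H.Core (toℕ s)))
                         (suc (toℕ s)) (residue-≡ s))

theorem2 :
    (∀ {p : Level} → ExcludedMiddle p) →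
    {a ℓ : Level} {Q : Set a} (_≤_ : Rel Q ℓ) → IsWellQuasiOrder _≤_ →
    (N : ℕ) → 1 ℕ.≤ N →
    (D : ℕ → LabelledGraphicSequence Q) →
    (∀ i → LabelledGraphicSequence.#entries> (D i) N ℕ.≤ N) →
    ∃₂ λ i j → (i ℕ.< j) × SequenceOrder _≤_ (D i) (D j)
theorem2 em _≤_ ≤-wqo N _ D few =
  let i , j , i<j , Dᵢ⊑Dⱼ = IsWellQuasiOrder.good ⊑-wqo D
  in  i , j , i<j , ⊑⇒SequenceOrder (few i) (few j) Dᵢ⊑Dⱼ
  where
  open Graphs em
  open SequenceWQO _≤_ ≤-wqo N
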